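{- Let $G$ be a connected graph. Then $G$ is a $3$-$\chi_g$-lower-game-vertex-critical graph if and only if $G$ is $P_4$, $C_3$, or $C_4$.
   Context: All graphs are simple, undirected and finite. The coloring game on a graph $G$ with color set $\{1,\ldots,k\}$ is played by Alice and Bob. Alice moves first and the players alternate turns; in each turn the player colors a previously uncolored vertex with a color from $\{1,\ldots,k\}$ different from the colors already given to its neighbors. If at some point there is an uncolored vertex having all colors $1,\ldots,k$ in its neighborhood, Bob wins; otherwise, if all vertices get colored, Alice wins. The game chromatic number $\chi_g(G)$ is the minimum $k$ for which Alice has a winning strategy on $G$. For $x\in V(G)$, $G-x$ is the graph obtained from $G$ by deleting $x$ and all edges incident with $x$. A graph $G$ is $k$-$\chi_g$-lower-game-vertex-critical if $\chi_g(G)=k$ and $\chi_g(G-x)<\chi_g(G)$ for every $x\in V(G)$. $P_n$ and $C_n$ denote the path and the cycle of order $n$ (number of vertices); "is" means "is isomorphic to". -}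

module Defs where

open import Data.Fin using (Fin; zero; suc; toℕ; punchIn)
open import Data.Maybe using (Maybe; just; nothing)
open import Data.Nat using (ℕ; suc; pred; _≤_; _<_; _≤?_; _≟_)
open import Data.Nat.Properties using (1+n≢n)
open import Data.Product using (_×_; _,_; ∃-syntax)
open import Data.Sum using (_⊎_; inj₁; inj₂; swap)
open import Data.Vec using (Vec; lookup; replicate; _[_]≔_)
open import Function.Bundles using (_↔_; _⇔_; module Inverse)
open import Relation.Binary.Construct.Closure.ReflexiveTransitive using (Star)
open import Relation.Binary.Core using (Rel)
open import Relation.Binary.Definitions using (Decidable; Irreflexive; Symmetric)
open import Relation.Binary.PropositionalEquality using (_≡_; _≢_; refl)
open import Relation.Nullary using (¬_)
open import Relation.Nullary.Decidable using (True; _×-dec_; _⊎-dec_)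
open import Level using (0ℓ)

------------------------------------------------------------------------
-- Finite simple graphs

record Graph (n : ℕ) : Set₁ where
  infix 4 _~_ _~?_
  field
    _~_      : Rel (Fin n) 0ℓ
    ~-sym    : Symmetric _~_
    ~-irrefl : Irreflexive _≡_ _~_
    _~?_     : Decidable _~_

Connected : ∀ {n} → Graph n → Set
Connected G = ∀ u v → Star _~_ u v
  where open Graph G

infix 4 _≅_

record _≅_ {m n : ℕ} (G : Graph m) (H : Graph n) : Set where
  private
    module G = Graph G
    module H = Graph H
  field
    bijection : Fin m ↔ Fin n
  open Inverse bijection using (to)
  field
    preserves : ∀ u v → (u G.~ v) ⇔ (to u H.~ to v)

-- The remaining vertices are renumbered by the increasing bijection
-- punchIn x from Fin n onto the elements of Fin (suc n) other than x.

infixl 6 _-_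

_-_ : ∀ {n} → Graph n → Fin n → Graph (pred n)
_-_ {suc n} G x = record
  { _~_      = λ u v → punchIn x u ~ punchIn x v
  ; ~-sym    = ~-sym
  ; ~-irrefl = λ { refl → ~-irrefl refl }
  ; _~?_     = λ u v → punchIn x u ~? punchIn x v
  }
  where open Graph G

P : ∀ n → Graph n
P n = record
  { _~_      = λ u v → Next u v ⊎ Next v u
  ; ~-sym    = swap
  ; ~-irrefl = λ { refl (inj₁ e) → 1+n≢n e ; refl (inj₂ e) → 1+n≢n e }
  ; _~?_     = λ u v → next? u v ⊎-dec next? v u
  }
  where
  Next : Rel (Fin n) 0ℓ
  Next u v = suc (toℕ u) ≡ toℕ v

  next? : Decidable Next
  next? u v = suc (toℕ u) ≟ toℕ v

C : ∀ n {3≤n : True (3 ≤? n)} → Graph n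
C n {3≤n} = record
  { _~_      = λ u v → Next u v ⊎ Next v u
  ; ~-sym    = swap
  ; ~-irrefl = λ { refl (inj₁ e) → next-irrefl _ e ; refl (inj₂ e) → next-irrefl _ e }
  ; _~?_     = λ u v → next? u v ⊎-dec next? v u
  }
  where
  Next : Rel (Fin n) 0ℓ
  Next u v = suc (toℕ u) ≡ toℕ v ⊎ (suc (toℕ u) ≡ n × toℕ v ≡ 0)

  next? : Decidable Next
  next? u v = (suc (toℕ u) ≟ toℕ v) ⊎-dec ((suc (toℕ u) ≟ n) ×-dec (toℕ v ≟ 0))

  1≢n : ∀ {m} → True (3 ≤? m) → 1 ≢ m
  1≢n () refl

  next-irrefl : ∀ u → ¬ Next u u
  next-irrefl u    (inj₁ e)       = 1+n≢n e
  next-irrefl zero (inj₂ (e , _)) = 1≢n 3≤n e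

------------------------------------------------------------------------
-- The coloring game with k colors

data Player : Set where
  alice bob : Player

-- A position maps each vertex to its color, or to nothing if it is
-- still uncolored.

Position : ℕ → ℕ → Set
Position n k = Vec (Maybe (Fin k)) n

module _ {n : ℕ} (G : Graph n) {k : ℕ} where
  open Graph G

  Complete : Position n k → Set
  Complete c = ∀ v → lookup c v ≢ nothing

  Legal : Position n k → Fin n → Fin k → Set
  Legal c v a = lookup c v ≡ nothing × (∀ w → v ~ w → lookup c w ≢ just a)

  Blocked : Position n k → Fin n → Set
  Blocked c v = lookup c v ≡ nothing × (∀ a → ∃[ w ] (v ~ w × lookup c w ≡ just a))

  -- An element of WinsFrom p c is a winning strategy tree for Alice from
  -- position c with player p to move.  A blocked vertex ends the game in
  -- Bob's favor, so no constructor applies to a position having one.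

  data WinsFrom : Player → Position n k → Set where
    complete   : ∀ {p c} → Complete c → WinsFrom p c
    alice-move : ∀ {c} → (∀ u → ¬ Blocked c u) →
                 ∀ v a → Legal c v a → WinsFrom bob (c [ v ]≔ just a) →
                 WinsFrom alice c
    bob-move   : ∀ {c} → (∀ u → ¬ Blocked c u) →
                 (∀ v a → Legal c v a → WinsFrom alice (c [ v ]≔ just a)) →
                 WinsFrom bob c

AliceWins : ∀ {n} → Graph n → ℕ → Set
AliceWins {n} G k = WinsFrom G {k} alice (replicate n nothing)

-- The game chromatic number, as a functional relation.

infix 4 χg[_]≡_

χg[_]≡_ : ∀ {n} → Graph n → ℕ → Set
χg[ G ]≡ k = AliceWins G k × (∀ j → AliceWins G j → k ≤ j)

LowerGameVertexCritical : ∀ {n} → ℕ → Graph n → Set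
LowerGameVertexCritical k G =
  χg[ G ]≡ k × (∀ x → ∃[ m ] (χg[ G - x ]≡ m × m < k))

{-# OPTIONS --safe #-}
-- With at most two colors Bob wins as soon as Alice's first vertex u starts
-- a path u v w with w ≢ u: he gives w the other color and v is blocked
-- (with one color, v already is).  Conversely Alice wins with two colors when
-- some u lies on every edge, by coloring u first.
--
-- Let x be a non-cut vertex of a connected critical G.  By the above G - x is
-- a star with some center u.  If x ~ u, then x and u have a common neighbor ℓ,
-- since otherwise u lies on every edge.  If x ≁ u, there is an induced path
-- x a u and, since a does not lie on every edge, a further neighbor b of u.
-- Deleting any other vertex would leave a graph in which every vertex starts
-- a path as above, so these three or four vertices are all of G.
module Submission where

open import Defs
open import Data.Empty using (⊥-elim)
open import Data.Fin using (Fin; zero; suc; punchIn; punchOut; _<_; _≟_)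
open import Data.Fin.Patterns using (0F; 1F; 2F; 3F)
open import Data.Fin.Properties
  using (<-cmp; all?; any?; ¬∀⟶∃¬; injective⇒≤; punchIn-injective; punchInᵢ≢i; punchIn-punchOut)
open import Data.Maybe using (just; nothing)
open import Data.Maybe.Properties using (≡-dec; just-injective)
open import Data.Nat as ℕ using (ℕ; zero; suc; z≤n; s≤s)
import Data.Nat.Properties as ℕ
open import Data.Product using (∃-syntax; _×_; _,_; proj₁)
open import Data.Sum using (_⊎_; inj₁; inj₂; [_,_]′)
open import Data.Unit using (⊤; tt)
open import Data.Vec using (Vec; []; _∷_; lookup; replicate; _[_]≔_)
import Data.Vec.Membership.DecPropositional as DecMembership
open import Data.Vec.Membership.Propositional using (_∈_; _∉_)
open import Data.Vec.Properties using (lookup∘update; lookup∘update′; lookup-replicate)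
open import Data.Vec.Relation.Unary.All as All using (All; []; _∷_)
open import Data.Vec.Relation.Unary.AllPairs using ([]; _∷_)
open import Data.Vec.Relation.Unary.Any using (here; there; index)
open import Data.Vec.Relation.Unary.Any.Properties using (lookup-index)
open import Data.Vec.Relation.Unary.Unique.Propositional using (Unique)
open import Data.Vec.Relation.Unary.Unique.Propositional.Properties using (lookup-injective)
open import Function using (_∘_)
open import Function.Bundles using (_⇔_; mk⇔; mk↔ₛ′; module Inverse; module Equivalence)
open import Relation.Binary.Construct.Closure.ReflexiveTransitive using (Star; ε; _◅_)
open import Relation.Binary.Definitions using (tri<; tri≈; tri>)
open import Relation.Binary.PropositionalEquality
  using (_≡_; _≢_; refl; sym; trans; cong; subst; subst₂)
open import Relation.Nullary using (¬_; Dec; yes; no; contradiction)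
open import Relation.Nullary.Decidable
  using (¬?; map′; _×-dec_; _⊎-dec_; _→-dec_; decidable-stable; from-yes; from-no)

private
  open module FinMembership {n} = DecMembership (_≟_ {n}) using (_∈?_)

  variable
    m n k : ℕ

-- Counting and comparing colored vertices.

uncolored : Position n k → ℕ
uncolored []            = 0
uncolored (nothing ∷ c) = suc (uncolored c)
uncolored (just _  ∷ c) = uncolored c

uncolored-[]≔ : ∀ (c : Position n k) v a → lookup c v ≡ nothing →
                uncolored c ≡ suc (uncolored (c [ v ]≔ just a))
uncolored-[]≔ (nothing ∷ c) zero    a _   = refl
uncolored-[]≔ (nothing ∷ c) (suc v) a v∅ = cong suc (uncolored-[]≔ c v a v∅)
uncolored-[]≔ (just _  ∷ c) (suc v) a v∅ = uncolored-[]≔ c v a v∅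

uncolored? : ∀ (c : Position n k) v → Dec (lookup c v ≡ nothing)
uncolored? c v = ≡-dec _≟_ (lookup c v) nothing

replicate-nothing : ∀ (w : Fin n) {a : Fin k} → lookup (replicate n nothing) w ≢ just a
replicate-nothing w e with trans (sym (lookup-replicate w nothing)) e
... | ()

distinct-colors : ∀ (c : Position n k) {v w a b} →
                  lookup c v ≡ just a → lookup c w ≡ just b → a ≢ b → v ≢ w
distinct-colors c va wb a≢b refl = a≢b (just-injective (trans (sym va) wb))

uncolored≢colored : ∀ (c : Position n k) {v w a} →
                    lookup c v ≡ nothing → lookup c w ≡ just a → v ≢ w
uncolored≢colored c v∅ wa refl with trans (sym v∅) wa
... | ()

-- Winning conditions for Alice and Bob on a fixed graph.

module _ (G : Graph n) where
  open Graph G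

  blocked⇒loses : ∀ {p} {c : Position n k} {v} → Blocked G c v → ¬ WinsFrom G p c
  blocked⇒loses b@(v∅ , _) (complete all)            = all _ v∅
  blocked⇒loses b          (alice-move free _ _ _ _) = free _ b
  blocked⇒loses b          (bob-move free _)         = free _ b

  free-color : ∀ (c : Position n k) v → ¬ Blocked G c v → lookup c v ≡ nothing →
               ∃[ a ] Legal G c v a
  free-color {k} c v free v∅
    with ¬∀⟶∃¬ k _ (λ a → any? λ w → (v ~? w) ×-dec ≡-dec _≟_ (lookup c w) (just a))
                    (λ all → free (v∅ , all))
  ... | a , unseen = a , v∅ , λ w v~w wa → unseen (w , v~w , wa)

  -- The invariant `I` lets Alice play any legal move: it survives every coloring and excludes
  -- blocked vertices, so an uncolored vertex always has a legal color until the position is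
  -- complete.
  never-blocked⇒wins :
    (I : Position n k → Set) →
    (∀ c v a → lookup c v ≡ nothing → I c → I (c [ v ]≔ just a)) →
    (∀ c v → I c → ¬ Blocked G c v) →
    ∀ p c → I c → WinsFrom G p c
  never-blocked⇒wins {k} I step free p c = go (uncolored c) p c refl
    where
    -- The number `r` of uncolored vertices makes the recursion structural; each move lowers it by
    -- one.
    go : ∀ r p c → uncolored c ≡ r → I c → WinsFrom G p c
    next : ∀ r p c v a → uncolored c ≡ r → lookup c v ≡ nothing → I c →
           WinsFrom G p (c [ v ]≔ just a)
    go r p c e i with any? (uncolored? c)
    ... | no none      = complete λ v v∅ → none (v , v∅)
    go r alice c e i | yes (v , v∅) =
      let a , legal = free-color c v (free c v i) v∅
      in alice-move (λ u → free c u i) v a legal (next r bob c v a e v∅ i)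
    go r bob c e i | yes _ =
      bob-move (λ u → free c u i) λ v a legal → next r alice c v a e (proj₁ legal) i
    next zero p c v a e v∅ i with trans (sym e) (uncolored-[]≔ c v a v∅)
    ... | ()
    next (suc r) p c v a e v∅ i =
      go r p _ (ℕ.suc-injective (trans (sym (uncolored-[]≔ c v a v∅)) e)) (step c v a v∅ i)

  Proper : Position n k → Set
  Proper c = ∀ {v w a} → v ~ w → lookup c v ≡ just a → lookup c w ≢ just a

  legal⇒proper : ∀ (c : Position n k) {v a} → Legal G c v a → Proper c → Proper (c [ v ]≔ just a)
  legal⇒proper c {v} {a} (v∅ , ok) proper {s} {t} s~t sb tb with s ≟ v | t ≟ v
  ... | yes refl | yes refl = ~-irrefl refl s~t
  ... | yes refl | no t≢v with trans (sym (lookup∘update v c _)) sb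
  ...   | refl = ok t s~t (trans (sym (lookup∘update′ t≢v c _)) tb)
  legal⇒proper c {v} {a} (v∅ , ok) proper {s} {t} s~t sb tb
      | no s≢v | yes refl with trans (sym (lookup∘update v c _)) tb
  ...   | refl = ok s (~-sym s~t) (trans (sym (lookup∘update′ s≢v c _)) sb)
  legal⇒proper c {v} {a} (v∅ , ok) proper {s} {t} s~t sb tb
      | no s≢v | no t≢v =
    proper s~t (trans (sym (lookup∘update′ s≢v c _)) sb) (trans (sym (lookup∘update′ t≢v c _)) tb)

  -- Follow a single branch of the strategy tree, choosing for Bob any legal move; one exists
  -- because no vertex is blocked.
  wins⇒proper-coloring : ∀ {p} {c : Position n k} → WinsFrom G p c → Proper c →
                         ∃[ c′ ] (Complete G {k} c′ × Proper c′)
  wins⇒proper-coloring {c = c} (complete all) proper = c , all , λ {v} → proper {v}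
  wins⇒proper-coloring {c = c} (alice-move _ _ _ legal win) proper =
    wins⇒proper-coloring win (legal⇒proper c legal proper)
  wins⇒proper-coloring {c = c} (bob-move free win) proper with any? (uncolored? c)
  ... | no none = c , (λ v v∅ → none (v , v∅)) , λ {v} → proper {v}
  ... | yes (v , v∅) =
    let a , legal = free-color c v (free v) v∅
    in wins⇒proper-coloring (win v a legal) (legal⇒proper c legal proper)

  edge⇒2≤ : ∀ {v w} → v ~ w → AliceWins G k → 2 ℕ.≤ k
  edge⇒2≤ {k} {v} {w} v~w win
    with wins⇒proper-coloring win (λ {v} _ e _ → replicate-nothing v e)
  ... | c , all , proper with lookup c v in ev | lookup c w in ew
  ...   | nothing | _       = contradiction ev (all v)
  ...   | just _  | nothing = contradiction ew (all w)
  edge⇒2≤ {zero}        v~w win | c , all , proper | just ()  | just _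
  edge⇒2≤ {suc zero}    v~w win | c , all , proper | just 0F  | just 0F =
    contradiction ew (proper v~w ev)
  edge⇒2≤ {suc (suc k)} v~w win | c , all , proper | just _   | just _  = s≤s (s≤s z≤n)

  -- The component of `u` is a star centered at `u`, possibly a single vertex. Other components are
  -- unrestricted.
  StarCenter : Fin n → Set
  StarCenter u = ∀ {v w} → u ~ v → v ~ w → w ≡ u

  -- The center is Alice's first vertex. The argument `z` excludes the empty graph, on which she
  -- wins without moving.
  wins⇒star-center : k ℕ.< 3 → Fin n → AliceWins G k → ∃[ u ] StarCenter u
  wins⇒star-center _ z (complete all) = contradiction (lookup-replicate z nothing) (all z)
  wins⇒star-center {k} k<3 z (alice-move _ u a _ win) =
    u , λ {_} {w} u~v v~w → decidable-stable (w ≟ u) (refute k<3 a win u~v v~w)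
    where
    start : Position n m
    start = replicate n nothing
    refute : m ℕ.< 3 → (a : Fin m) → WinsFrom G bob (start [ u ]≔ just a) →
             ∀ {v w} → u ~ v → v ~ w → ¬ w ≢ u
    refute {1} _ 0F win {v} u~v _ _ = blocked⇒loses (v∅ , λ { 0F → u , ~-sym u~v , u0 }) win
      where
      u0 = lookup∘update u start (just 0F)
      v∅ = trans (lookup∘update′ (λ { refl → ~-irrefl refl u~v }) start _) (lookup-replicate v nothing)
    refute {2} _ a (complete all) {w = w} _ _ w≢u =
      all w (trans (lookup∘update′ w≢u start _) (lookup-replicate w nothing))
    refute {2} _ a (bob-move _ win) {v} {w} u~v v~w w≢u =
      blocked⇒loses (v∅ , both a ua wb) (win w (other a) (w∅ , legal))
      where
      other : Fin 2 → Fin 2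
      other 0F = 1F
      other 1F = 0F
      other≢ : ∀ a → a ≢ other a
      other≢ 0F ()
      other≢ 1F ()
      c₁ = start [ u ]≔ just a
      c₂ = c₁ [ w ]≔ just (other a)
      uncolored-≢u : ∀ {t} → t ≢ u → lookup c₁ t ≡ nothing
      uncolored-≢u {t} t≢u = trans (lookup∘update′ t≢u start _) (lookup-replicate t nothing)
      w∅ = uncolored-≢u w≢u
      -- Only `u` is colored, and its color differs from the one chosen for `w`, so Bob's move is
      -- legal even when `w ~ u`.
      legal : ∀ t → w ~ t → lookup c₁ t ≢ just (other a)
      legal t _ e with t ≟ u
      ... | yes refl = other≢ a (just-injective (trans (sym (lookup∘update u start _)) e))
      ... | no t≢u = uncolored≢colored c₁ (uncolored-≢u t≢u) e refl
      v∅ : lookup c₂ v ≡ nothing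
      v∅ = trans (lookup∘update′ (λ { refl → ~-irrefl refl v~w }) c₁ _)
                 (uncolored-≢u λ { refl → ~-irrefl refl u~v })
      ua : lookup c₂ u ≡ just a
      ua = trans (lookup∘update′ (w≢u ∘ sym) c₁ _) (lookup∘update u start _)
      wb : lookup c₂ w ≡ just (other a)
      wb = lookup∘update w c₁ _
      both : ∀ a → lookup c₂ u ≡ just a → lookup c₂ w ≡ just (other a) →
             ∀ b → ∃[ t ] (v ~ t × lookup c₂ t ≡ just b)
      both 0F ua wb 0F = u , ~-sym u~v , ua
      both 0F ua wb 1F = w , v~w , wb
      both 1F ua wb 0F = w , v~w , wb
      both 1F ua wb 1F = u , ~-sym u~v , ua
    refute {suc (suc (suc _))} (s≤s (s≤s (s≤s ())))

  OnEveryEdge : Fin n → Set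
  OnEveryEdge u = ∀ {v w} → v ~ w → v ≡ u ⊎ w ≡ u

  -- After the first move `u` keeps color `0F`. A blocked vertex would have a neighbor of color
  -- `1F`; one end of that edge is `u`, which is neither uncolored nor of color `1F`.
  on-every-edge⇒wins : ∀ {u} → OnEveryEdge u → AliceWins G 2
  on-every-edge⇒wins {u} cover =
    alice-move (λ v (_ , seen) → let w , _ , e = seen 0F in replicate-nothing w e)
      u 0F (lookup-replicate u nothing , λ w _ → replicate-nothing w)
      (never-blocked⇒wins (λ c → lookup c u ≡ just 0F)
        (λ c v a v∅ u0 → trans (lookup∘update′ (uncolored≢colored c v∅ u0 ∘ sym) c _) u0)
        free bob _ (lookup∘update u (replicate n nothing) _))
    where
    free : ∀ c v → lookup c u ≡ just 0F → ¬ Blocked G c v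
    free c v u0 (v∅ , seen) with seen 1F
    ... | w , v~w , w1 =
      [ uncolored≢colored c v∅ u0 , distinct-colors c w1 u0 (λ ()) ]′ (cover v~w)

  MaxDegree≤2 : Set
  MaxDegree≤2 = ∀ v w₁ w₂ w₃ → v ~ w₁ → v ~ w₂ → v ~ w₃ → w₁ ≡ w₂ ⊎ w₁ ≡ w₃ ⊎ w₂ ≡ w₃

  -- A blocked vertex would have three differently colored, hence distinct, neighbors. The invariant
  -- is therefore the trivial one.
  max-degree≤2⇒wins : MaxDegree≤2 → AliceWins G 3
  max-degree≤2⇒wins degree = never-blocked⇒wins (λ _ → ⊤) (λ _ _ _ _ i → i) free alice _ tt
    where
    free : ∀ c v → ⊤ → ¬ Blocked G c v
    free c v _ (_ , seen) with seen 0F | seen 1F | seen 2F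
    ... | _ , v~0 , e0 | _ , v~1 , e1 | _ , v~2 , e2 =
      [ distinct-colors c e0 e1 (λ ())
      , [ distinct-colors c e0 e2 (λ ()) , distinct-colors c e1 e2 (λ ()) ]′ ]′
        (degree v _ _ _ v~0 v~1 v~2)

  -- `StarCenter` for `G - x`, phrased with vertices of `G` to keep `punchIn` out of the structural
  -- argument.
  StarCenterAvoiding : Fin n → Fin n → Set
  StarCenterAvoiding x u = ∀ {v w} → v ≢ x → w ≢ x → u ~ v → v ~ w → w ≡ u

  -- Conditions on G that pass to isomorphic graphs and are decidable for a given graph.
  record Criterion : Set where
    field
      vertex : Fin n
      degree : MaxDegree≤2
      walk   : ∀ u → ∃[ v ] ∃[ w ] (u ~ v × v ~ w × w ≢ u)
      cover  : ∀ x → ∃[ u ] (u ≢ x × (∀ v w → v ~ w → v ≡ x ⊎ w ≡ x ⊎ v ≡ u ⊎ w ≡ u))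
      edge   : ∀ x → ∃[ v ] ∃[ w ] (v ~ w × v ≢ x × w ≢ x)

-- Criticality of the three listed graphs.

criterion⇒χg[G-x]<3 : ∀ {G : Graph n} → Criterion G → ∀ x → ∃[ m ] (χg[ G - x ]≡ m × m ℕ.< 3)
criterion⇒χg[G-x]<3 {suc n} {G} crit x with Criterion.edge crit x | Criterion.cover crit x
... | v , w , v~w , v≢x , w≢x | u , u≢x , covers =
  -- The vertex from `cover` lies on every edge of `G - x`, so two colors suffice; the surviving
  -- edge from `edge` rules out fewer.
  2 , (on-every-edge⇒wins (G - x) on-every , λ j → edge⇒2≤ (G - x) v~w′) , ℕ.≤-refl
  where
  open Graph G
  v~w′ = subst₂ _~_ (sym (punchIn-punchOut (v≢x ∘ sym))) (sym (punchIn-punchOut (w≢x ∘ sym))) v~w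
  inject : ∀ {s} → punchIn x s ≡ u → s ≡ punchOut (u≢x ∘ sym)
  inject e = punchIn-injective x _ _ (trans e (sym (punchIn-punchOut _)))
  on-every : OnEveryEdge (G - x) (punchOut (u≢x ∘ sym))
  on-every {s} {t} s~t with covers _ _ s~t
  ... | inj₁ e               = contradiction e (punchInᵢ≢i x s)
  ... | inj₂ (inj₁ e)        = contradiction e (punchInᵢ≢i x t)
  ... | inj₂ (inj₂ (inj₁ e)) = inj₁ (inject e)
  ... | inj₂ (inj₂ (inj₂ e)) = inj₂ (inject e)

-- Three colors suffice by the degree bound. Fewer would yield a star center, which `walk` excludes
-- at each vertex.
criterion⇒critical : ∀ {G : Graph n} → Criterion G → LowerGameVertexCritical 3 G
criterion⇒critical {G = G} crit =
  (max-degree≤2⇒wins G degree , lower) , criterion⇒χg[G-x]<3 crit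
  where
  open Criterion crit
  lower : ∀ j → AliceWins G j → 3 ℕ.≤ j
  lower j win with 3 ℕ.≤? j
  ... | yes 3≤j = 3≤j
  ... | no  3≰j with wins⇒star-center G (ℕ.≰⇒> 3≰j) vertex win
  ...   | u , center with walk u
  ...     | v , w , u~v , v~w , w≢u = contradiction (center u~v v~w) w≢u

criterion-≅ : ∀ {G : Graph m} {H : Graph n} → G ≅ H → Criterion H → Criterion G
criterion-≅ {G = G} {H} iso crit = record
  { vertex = from vertex
  ; degree = λ v w₁ w₂ w₃ e₁ e₂ e₃ →
      [ inj₁ ∘ injective , [ inj₂ ∘ inj₁ ∘ injective , inj₂ ∘ inj₂ ∘ injective ]′ ]′
        (degree (to v) (to w₁) (to w₂) (to w₃) (fwd e₁) (fwd e₂) (fwd e₃))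
  ; walk = λ u → let v , w , e , f , w≢u = walk (to u) in
      from v , from w , pull (sym (strictlyInverseʳ u)) refl e , pull refl refl f , apart w≢u
  ; cover = λ x → let u , u≢x , covers = cover (to x) in
      from u , apart u≢x , λ v w v~w →
        [ inj₁ ∘ injective
        , [ inj₂ ∘ inj₁ ∘ injective
          , [ inj₂ ∘ inj₂ ∘ inj₁ ∘ back , inj₂ ∘ inj₂ ∘ inj₂ ∘ back ]′ ]′ ]′
          (covers (to v) (to w) (fwd v~w))
  ; edge = λ x → let v , w , e , v≢x , w≢x = edge (to x) in
      from v , from w , pull refl refl e , apart v≢x , apart w≢x
  }
  where
  module G = Graph G
  module H = Graph H
  open Criterion crit
  open Inverse (_≅_.bijection iso) using (to; from; strictlyInverseˡ; strictlyInverseʳ)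
  back : ∀ {v w} → to v ≡ w → v ≡ from w
  back {v} e = trans (sym (strictlyInverseʳ v)) (cong from e)
  injective : ∀ {v w} → to v ≡ to w → v ≡ w
  injective e = trans (back e) (strictlyInverseʳ _)
  fwd : ∀ {v w} → v G.~ w → to v H.~ to w
  fwd = Equivalence.to (_≅_.preserves iso _ _)
  pull : ∀ {v w s t} → s ≡ from v → t ≡ from w → v H.~ w → s G.~ t
  pull refl refl e = Equivalence.from (_≅_.preserves iso _ _)
    (subst₂ H._~_ (sym (strictlyInverseˡ _)) (sym (strictlyInverseˡ _)) e)
  apart : ∀ {v x} → v ≢ to x → from v ≢ x
  apart v≢x refl = v≢x (sym (strictlyInverseˡ _))

criterion? : ∀ (G : Graph (suc n)) → Dec (Criterion G)
criterion? G = map′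
  (λ (d , w , c , e) → record { vertex = 0F ; degree = d ; walk = w ; cover = c ; edge = e })
  (λ crit → let open Criterion crit in degree , walk , cover , edge)
  ( (all? λ v → all? λ w₁ → all? λ w₂ → all? λ w₃ →
       (v ~? w₁) →-dec ((v ~? w₂) →-dec ((v ~? w₃) →-dec
         ((w₁ ≟ w₂) ⊎-dec (w₁ ≟ w₃) ⊎-dec (w₂ ≟ w₃)))))
  ×-dec (all? λ u → any? λ v → any? λ w → (u ~? v) ×-dec (v ~? w) ×-dec ¬? (w ≟ u))
  ×-dec (all? λ x → any? λ u → ¬? (u ≟ x) ×-dec all? λ v → all? λ w →
       (v ~? w) →-dec ((v ≟ x) ⊎-dec (w ≟ x) ⊎-dec (v ≟ u) ⊎-dec (w ≟ u)))
  ×-dec (all? λ x → any? λ v → any? λ w → (v ~? w) ×-dec ¬? (v ≟ x) ×-dec ¬? (w ≟ x)))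
  where open Graph G

-- Isomorphisms from vertex enumerations.

SameAdjacency : (G : Graph m) (H : Graph n) → Vec (Fin m) n → Fin n → Fin n → Set
SameAdjacency G H xs i j =
  (lookup xs i G.~ lookup xs j × i H.~ j) ⊎
  (lookup xs i ≢ lookup xs j × ¬ lookup xs i G.~ lookup xs j × ¬ i H.~ j)
  where
  module G = Graph G
  module H = Graph H

-- Pairs `i < j` suffice by symmetry and irreflexivity. They also make the entries of `xs` distinct:
-- adjacent entries differ by irreflexivity, nonadjacent ones by the inequality in `SameAdjacency`.
enumeration⇒≅ : ∀ {G : Graph m} {H : Graph n} (xs : Vec (Fin m) n) → (∀ v → v ∈ xs) →
                (∀ i j → i < j → SameAdjacency G H xs i j) → G ≅ H
enumeration⇒≅ {m} {n} {G} {H} xs covers same = record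
  { bijection = mk↔ₛ′ to (lookup xs) (λ i → distinct _ i (lookup-to (lookup xs i))) lookup-to
  ; preserves = λ u v → let g⇒h , h⇒g = same-~ (to u) (to v) in
      mk⇔ (g⇒h ∘ subst₂ G._~_ (sym (lookup-to u)) (sym (lookup-to v)))
          (subst₂ G._~_ (lookup-to u) (lookup-to v) ∘ h⇒g)
  }
  where
  module G = Graph G
  module H = Graph H
  to : Fin m → Fin n
  to v = index (covers v)
  lookup-to : ∀ v → lookup xs (to v) ≡ v
  lookup-to v = sym (lookup-index (covers v))

  distinct-< : ∀ {i j} → i < j → lookup xs i ≢ lookup xs j
  distinct-< {i} {j} i<j e with same i j i<j
  ... | inj₁ (i~j , _)     = G.~-irrefl e i~j
  ... | inj₂ (i≢j , _ , _) = i≢j e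
  distinct : ∀ i j → lookup xs i ≡ lookup xs j → i ≡ j
  distinct i j e with <-cmp i j
  ... | tri< i<j _ _ = contradiction e (distinct-< i<j)
  ... | tri≈ _ i≡j _ = i≡j
  ... | tri> _ _ j<i = contradiction (sym e) (distinct-< j<i)

  same-< : ∀ {i j} → i < j → (lookup xs i G.~ lookup xs j → i H.~ j) × (i H.~ j → lookup xs i G.~ lookup xs j)
  same-< {i} {j} i<j with same i j i<j
  ... | inj₁ (g , h)      = (λ _ → h) , (λ _ → g)
  ... | inj₂ (_ , ¬g , ¬h) = (λ g → contradiction g ¬g) , (λ h → contradiction h ¬h)
  same-~ : ∀ i j → (lookup xs i G.~ lookup xs j → i H.~ j) × (i H.~ j → lookup xs i G.~ lookup xs j)
  same-~ i j with <-cmp i j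
  ... | tri< i<j _ _  = same-< i<j
  ... | tri≈ _ refl _ = (λ g → contradiction g (G.~-irrefl refl)) , (λ h → contradiction h (H.~-irrefl refl))
  ... | tri> _ _ j<i  = let g⇒h , h⇒g = same-< j<i in H.~-sym ∘ g⇒h ∘ G.~-sym , G.~-sym ∘ h⇒g ∘ H.~-sym

-- Graph search and non-cut vertices.

∉⇒All≢ : ∀ {A : Set} {y} {xs : Vec A k} → y ∉ xs → All (y ≢_) xs
∉⇒All≢ {xs = []}     _    = []
∉⇒All≢ {xs = x ∷ xs} y∉xs = y∉xs ∘ here ∷ ∉⇒All≢ (y∉xs ∘ there)

module _ (G : Graph n) where
  open Graph G

  -- A Grown vector lists vertices in reverse order of a graph search, so its
  -- head is not a cut vertex of the subgraph induced on its members.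
  data Grown : Vec (Fin n) k → Set where
    root : ∀ r → Grown (r ∷ [])
    grow : ∀ {xs : Vec (Fin n) k} {y z} → y ∉ xs → z ∈ xs → z ~ y → Grown xs → Grown (y ∷ xs)

  grown⇒unique : ∀ {xs : Vec (Fin n) k} → Grown xs → Unique xs
  grown⇒unique (root r)        = [] ∷ []
  grown⇒unique (grow y∉xs _ _ g) = ∉⇒All≢ y∉xs ∷ grown⇒unique g

  boundary-edge : ∀ {xs : Vec (Fin n) k} {s t} → Star _~_ s t → s ∈ xs → t ∉ xs →
                  ∃[ y ] ∃[ z ] (y ∉ xs × z ∈ xs × z ~ y)
  boundary-edge ε s∈ t∉ = contradiction s∈ t∉
  boundary-edge {xs = xs} (_◅_ {j = j} s~j path) s∈ t∉ with j ∈? xs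
  ... | yes j∈ = boundary-edge path j∈ t∉
  ... | no  j∉ = _ , _ , j∉ , s∈ , s~j

  -- Boundary vertices are added while some vertex is missing, for at most `n` rounds.
  connected⇒spanning-grown : Connected G → Fin n →
    ∃[ k ] ∃[ xs ] (Grown {suc k} xs × (∀ v → v ∈ xs))
  connected⇒spanning-grown connected r with search n
    where
    search : ∀ k → (∃[ k ] ∃[ xs ] (Grown {suc k} xs × (∀ v → v ∈ xs))) ⊎ ∃[ xs ] Grown {suc k} xs
    search zero = inj₂ (_ , root r)
    search (suc k) with search k
    ... | inj₁ found = inj₁ found
    ... | inj₂ (xs@(x ∷ _) , g) with all? (_∈? xs)
    ...   | yes all∈ = inj₁ (_ , xs , g , all∈)
    ...   | no  ¬all∈ with ¬∀⟶∃¬ n _ (_∈? xs) ¬all∈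
    ...     | t , t∉ =
      let y , z , y∉ , z∈ , z~y = boundary-edge (connected x t) (here refl) t∉
      in inj₂ (y ∷ xs , grow y∉ z∈ z~y g)
  ... | inj₁ found   = found
  -- Still searching after `n` rounds would mean `suc n` distinct vertices among `n`.
  ... | inj₂ (_ , g) =
    contradiction (injective⇒≤ (λ {i} {j} → lookup-injective (grown⇒unique g) i j)) ℕ.1+n≰n

  -- Connectedness of the induced subgraph is expressed as propagation of a predicate along edges
  -- inside `xs`, without building paths. The newest vertex is joined to the rest through its parent
  -- `z`.
  grown⇒connected : ∀ {xs : Vec (Fin n) k} → Grown xs → (Q : Fin n → Set) →
    (∀ {s t} → s ∈ xs → t ∈ xs → s ~ t → Q s → Q t) →
    ∀ {v} → v ∈ xs → Q v → All Q xs
  grown⇒connected (root r) Q closed (here refl) q = q ∷ []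
  grown⇒connected (grow _ z∈ z~y g) Q closed (here refl) q =
    q ∷ grown⇒connected g Q (λ s∈ t∈ → closed (there s∈) (there t∈)) z∈
          (closed (here refl) (there z∈) (~-sym z~y) q)
  grown⇒connected (grow _ z∈ z~y g) Q closed (there v∈) q =
    let qs = grown⇒connected g Q (λ s∈ t∈ → closed (there s∈) (there t∈)) v∈ q
    in closed (there z∈) (here refl) z~y (All.lookup qs z∈) ∷ qs

-- Structure of a connected critical graph.

wins⇒star-center-avoiding : ∀ (G : Graph n) {x y} → y ≢ x → k ℕ.< 3 → AliceWins (G - x) k →
  ∃[ u ] (u ≢ x × StarCenterAvoiding G x u)
wins⇒star-center-avoiding {suc n} G {x} y≢x k<3 win
  -- The vertex `y` survives in `G - x`, which is thus nonempty.
  with wins⇒star-center (G - x) k<3 (punchOut (y≢x ∘ sym)) win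
... | u , center = punchIn x u , punchInᵢ≢i x u , avoiding
  where
  open Graph G
  avoiding : StarCenterAvoiding G x (punchIn x u)
  avoiding {v} {w} v≢x w≢x u~v v~w =
    trans (sym (out w≢x)) (cong (punchIn x) (center
      (subst (punchIn x u ~_) (sym (out v≢x)) u~v)
      (subst₂ _~_ (sym (out v≢x)) (sym (out w≢x)) v~w)))
    where
    out : ∀ {t} (t≢x : t ≢ x) → punchIn x (punchOut (t≢x ∘ sym)) ≡ t
    out t≢x = punchIn-punchOut (t≢x ∘ sym)

module _ (G : Graph n)
  (no-vertex-on-every-edge : ∀ u → ¬ OnEveryEdge G u)
  (star-center-avoiding : ∀ {x y} → y ≢ x → ∃[ u ] (u ≢ x × StarCenterAvoiding G x u))
  where
  open Graph G

  ~⇒≢ : ∀ {v w} → v ~ w → v ≢ w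
  ~⇒≢ v~w v≡w = ~-irrefl v≡w v~w

  -- Such walks leave no candidate for the star center that criticality provides in `G - y`; this
  -- excludes any further vertex `y` below.
  every-vertex-starts-a-walk⇒⊥ : ∀ {y z} → z ≢ y →
    ¬ (∀ u → u ≢ y → ∃[ v ] ∃[ w ] (v ≢ y × w ≢ y × u ~ v × v ~ w × w ≢ u))
  every-vertex-starts-a-walk⇒⊥ z≢y walk with star-center-avoiding z≢y
  ... | u , u≢y , center with walk u u≢y
  ...   | v , w , v≢y , w≢y , u~v , v~w , w≢u = w≢u (center v≢y w≢y u~v v~w)

  -- `center` makes the component of `u` in `G - x` a star, and `spoke` makes that component all of
  -- `G - x`.
  module _ {x u} (u≢x : u ≢ x) (center : StarCenterAvoiding G x u)
           (spoke : ∀ {v} → v ≢ x → v ≢ u → u ~ v) where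

    -- Otherwise edges at `x` can only go to `u` and all other edges are spokes, so `u` lies on
    -- every edge.
    apex-neighbor : ∃[ a ] (a ≢ u × x ~ a)
    apex-neighbor with any? (λ a → ¬? (a ≟ u) ×-dec (x ~? a))
    ... | yes found = found
    ... | no  none  = ⊥-elim (no-vertex-on-every-edge u on-every)
      where
      on-every : OnEveryEdge G u
      on-every {v} {w} v~w with v ≟ u | w ≟ u | v ≟ x | w ≟ x
      ... | yes v≡u | _       | _        | _        = inj₁ v≡u
      ... | no _    | yes w≡u | _        | _        = inj₂ w≡u
      ... | no _    | no w≢u  | yes refl | _        = contradiction (w , w≢u , v~w) none
      ... | no v≢u  | no _    | no _     | yes refl = contradiction (v , v≢u , ~-sym v~w) none
      ... | no v≢u  | no _    | no v≢x   | no w≢x   = inj₂ (center v≢x w≢x (spoke v≢x v≢u) v~w)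

    triangle⇒C₃ : ∀ {a} → a ≢ u → x ~ a → x ~ u → G ≅ C 3
    triangle⇒C₃ {a} a≢u x~a x~u = enumeration⇒≅ xs covers (λ where
      0F 1F _ → inj₁ (x~u , from-yes (Graph._~?_ (C 3) 0F 1F))
      0F 2F _ → inj₁ (x~a , from-yes (Graph._~?_ (C 3) 0F 2F))
      1F 2F _ → inj₁ (u~a , from-yes (Graph._~?_ (C 3) 1F 2F))
      _ 0F ()
      (suc _) 1F (s≤s ())
      2F 2F (s≤s (s≤s ())))
      where
      a≢x = ~⇒≢ (~-sym x~a)
      u~a = spoke a≢x a≢u
      xs : Vec (Fin n) 3
      xs = x ∷ u ∷ a ∷ []
      covers : ∀ y → y ∈ xs
      covers y with y ∈? xs
      ... | yes y∈ = y∈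
      ... | no  y∉ = contradiction walk (every-vertex-starts-a-walk⇒⊥ x≢y)
        where
        x≢y : x ≢ y
        x≢y e = y∉ (here (sym e))
        u≢y : u ≢ y
        u≢y e = y∉ (there (here (sym e)))
        a≢y : a ≢ y
        a≢y e = y∉ (there (there (here (sym e))))
        walk : ∀ s → s ≢ y → ∃[ v ] ∃[ w ] (v ≢ y × w ≢ y × s ~ v × v ~ w × w ≢ s)
        walk s _ with s ≟ x | s ≟ u
        ... | yes refl | _        = u , a , u≢y , a≢y , x~u , u~a , a≢x
        ... | no _     | yes refl = x , a , x≢y , a≢y , ~-sym x~u , x~a , a≢u
        -- Any other vertex, `a` included, is a leaf: go to `u` and on to `x`.
        ... | no s≢x   | no s≢u   = u , x , u≢y , x≢y , ~-sym (spoke s≢x s≢u) , ~-sym x~u , s≢x ∘ sym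

    -- On `x`, `u` and `a` alone, the only possible edge avoiding `a` joins `x` to `u`, which `x≁u`
    -- forbids; then `a` lies on every edge.
    fourth-vertex : ∀ {a} → ¬ x ~ u → ∃[ b ] (b ≢ x × b ≢ u × b ≢ a)
    fourth-vertex {a} x≁u
      with any? (λ b → ¬? (b ≟ x) ×-dec ¬? (b ≟ u) ×-dec ¬? (b ≟ a))
    ... | yes found = found
    ... | no  none  = ⊥-elim (no-vertex-on-every-edge a on-every)
      where
      x-or-u : ∀ {v} → v ≢ a → v ≢ x → v ≡ u
      x-or-u {v} v≢a v≢x = decidable-stable (v ≟ u) λ v≢u → none (v , v≢x , v≢u , v≢a)
      on-every : OnEveryEdge G a
      on-every {v} {w} v~w with v ≟ a | w ≟ a | v ≟ x | w ≟ x
      ... | yes v≡a | _       | _        | _        = inj₁ v≡a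
      ... | no _    | yes w≡a | _        | _        = inj₂ w≡a
      ... | no _    | no _    | yes refl | yes refl = contradiction v~w (~-irrefl refl)
      ... | no _    | no w≢a  | yes refl | no w≢x   =
        contradiction (subst (x ~_) (x-or-u w≢a w≢x) v~w) x≁u
      ... | no v≢a  | no _    | no v≢x   | yes refl =
        contradiction (subst (x ~_) (x-or-u v≢a v≢x) (~-sym v~w)) x≁u
      ... | no v≢a  | no w≢a  | no v≢x   | no w≢x   =
        contradiction v~w (~-irrefl (trans (x-or-u v≢a v≢x) (sym (x-or-u w≢a w≢x))))

    module _ {a b} (a≢u : a ≢ u) (x~a : x ~ a) (x≁u : ¬ x ~ u)
             (b≢x : b ≢ x) (b≢u : b ≢ u) (b≢a : b ≢ a) where

      private
        xs : Vec (Fin n) 4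
        xs = x ∷ a ∷ u ∷ b ∷ []
        a≢x = ~⇒≢ (~-sym x~a)
        u~a = spoke a≢x a≢u
        u~b = spoke b≢x b≢u
        a≁b : ¬ a ~ b
        a≁b a~b = b≢u (center a≢x b≢x u~a a~b)

      path-covers : ∀ y → y ∈ xs
      path-covers y with y ∈? xs
      ... | yes y∈ = y∈
      ... | no  y∉ = contradiction walk (every-vertex-starts-a-walk⇒⊥ x≢y)
        where
        x≢y : x ≢ y
        x≢y e = y∉ (here (sym e))
        a≢y : a ≢ y
        a≢y e = y∉ (there (here (sym e)))
        u≢y : u ≢ y
        u≢y e = y∉ (there (there (here (sym e))))
        b≢y : b ≢ y
        b≢y e = y∉ (there (there (there (here (sym e)))))
        walk : ∀ s → s ≢ y → ∃[ v ] ∃[ w ] (v ≢ y × w ≢ y × s ~ v × v ~ w × w ≢ s)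
        walk s _ with s ≟ x | s ≟ u | s ≟ a
        ... | yes refl | _        | _        = a , u , a≢y , u≢y , x~a , ~-sym u~a , u≢x
        ... | no _     | yes refl | _        = a , x , a≢y , x≢y , u~a , ~-sym x~a , u≢x ∘ sym
        -- Here the fourth vertex enters: `u` is not adjacent to `x`, so the walk from `a` through
        -- `u` continues to `b`.
        ... | no _     | no _     | yes refl = u , b , u≢y , b≢y , ~-sym u~a , u~b , b≢a
        ... | no s≢x   | no s≢u   | no s≢a   =
          u , a , u≢y , a≢y , ~-sym (spoke s≢x s≢u) , u~a , s≢a ∘ sym

      -- In the order `x`, `a`, `u`, `b` consecutive vertices are adjacent, while `x`, `u` and `a`,
      -- `b` are not. Only the pair `x`, `b` is open, and it decides between cycle and path.
      path⇒P₄⊎C₄ : G ≅ P 4 ⊎ G ≅ C 4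
      path⇒P₄⊎C₄ with x ~? b
      ... | yes x~b = inj₂ (enumeration⇒≅ xs path-covers λ where
        0F 1F _ → inj₁ (x~a , from-yes (Graph._~?_ (C 4) 0F 1F))
        0F 2F _ → inj₂ (u≢x ∘ sym , x≁u , from-no (Graph._~?_ (C 4) 0F 2F))
        0F 3F _ → inj₁ (x~b , from-yes (Graph._~?_ (C 4) 0F 3F))
        1F 2F _ → inj₁ (~-sym u~a , from-yes (Graph._~?_ (C 4) 1F 2F))
        1F 3F _ → inj₂ (b≢a ∘ sym , a≁b , from-no (Graph._~?_ (C 4) 1F 3F))
        2F 3F _ → inj₁ (u~b , from-yes (Graph._~?_ (C 4) 2F 3F))
        _  0F ()
        (suc _) 1F (s≤s ())
        (suc (suc _)) 2F (s≤s (s≤s ()))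
        3F 3F (s≤s (s≤s (s≤s ()))))
      ... | no  x≁b = inj₁ (enumeration⇒≅ xs path-covers λ where
        0F 1F _ → inj₁ (x~a , from-yes (Graph._~?_ (P 4) 0F 1F))
        0F 2F _ → inj₂ (u≢x ∘ sym , x≁u , from-no (Graph._~?_ (P 4) 0F 2F))
        0F 3F _ → inj₂ (b≢x ∘ sym , x≁b , from-no (Graph._~?_ (P 4) 0F 3F))
        1F 2F _ → inj₁ (~-sym u~a , from-yes (Graph._~?_ (P 4) 1F 2F))
        1F 3F _ → inj₂ (b≢a ∘ sym , a≁b , from-no (Graph._~?_ (P 4) 1F 3F))
        2F 3F _ → inj₁ (u~b , from-yes (Graph._~?_ (P 4) 2F 3F))
        _  0F ()
        (suc _) 1F (s≤s ())
        (suc (suc _)) 2F (s≤s (s≤s ()))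
        3F 3F (s≤s (s≤s (s≤s ()))))

    non-cut-star⇒P₄⊎C₃⊎C₄ : G ≅ P 4 ⊎ G ≅ C 3 ⊎ G ≅ C 4
    non-cut-star⇒P₄⊎C₃⊎C₄ with apex-neighbor
    ... | a , a≢u , x~a with x ~? u
    ...   | yes x~u = inj₂ (inj₁ (triangle⇒C₃ a≢u x~a x~u))
    ...   | no  x≁u =
      let b , b≢x , b≢u , b≢a = fourth-vertex {a} x≁u
      in [ inj₁ , inj₂ ∘ inj₂ ]′ (path⇒P₄⊎C₄ a≢u x~a x≁u b≢x b≢u b≢a)

  connected⇒P₄⊎C₃⊎C₄ : Connected G → Fin n → G ≅ P 4 ⊎ G ≅ C 3 ⊎ G ≅ C 4
  connected⇒P₄⊎C₃⊎C₄ connected r with connected⇒spanning-grown G connected r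
  ... | _ , _ , root r , covers = ⊥-elim (no-vertex-on-every-edge r on-every)
    where
    on-every : OnEveryEdge G r
    on-every {v} _ with covers v
    ... | here v≡r = inj₁ v≡r
  -- The vertex `x` found last by the search is not a cut vertex: `g` shows that the rest is
  -- connected.
  ... | _ , _ , grow {xs = xs} {x} {z} x∉ z∈ _ g , covers
    with star-center-avoiding {x} {z} (λ { refl → x∉ z∈ })
  ...   | u , u≢x , center = non-cut-star⇒P₄⊎C₃⊎C₄ u≢x center spoke
    where
    member : ∀ {v} → v ≢ x → v ∈ xs
    member {v} v≢x with covers v
    ... | here v≡x = contradiction v≡x v≢x
    ... | there v∈ = v∈
    ≢x : ∀ {v} → v ∈ xs → v ≢ x
    ≢x v∈ refl = x∉ v∈
    -- Being `u` or a neighbor of `u` spreads along edges avoiding `x`, since a neighbor of a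
    -- neighbor of `u` is `u` itself. It therefore reaches all of the connected rest.
    closed : ∀ {s t} → s ∈ xs → t ∈ xs → s ~ t → s ≡ u ⊎ u ~ s → t ≡ u ⊎ u ~ t
    closed _  _  s~t (inj₁ refl) = inj₂ s~t
    closed s∈ t∈ s~t (inj₂ u~s)  = inj₁ (center (≢x s∈) (≢x t∈) u~s s~t)
    spoke : ∀ {v} → v ≢ x → v ≢ u → u ~ v
    spoke v≢x v≢u
      with All.lookup (grown⇒connected G g (λ v → v ≡ u ⊎ u ~ v) closed (member u≢x) (inj₁ refl))
                      (member v≢x)
    ... | inj₁ v≡u = contradiction v≡u v≢u
    ... | inj₂ u~v = u~v

theorem9 : ∀ {n} (G : Graph n) → Connected G →
    LowerGameVertexCritical 3 G ⇔ (G ≅ P 4 ⊎ G ≅ C 3 ⊎ G ≅ C 4)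
theorem9 G connected = mk⇔ (forward G connected) λ where
    (inj₁ G≅P₄)        → criterion⇒critical (criterion-≅ G≅P₄ (from-yes (criterion? (P 4))))
    (inj₂ (inj₁ G≅C₃)) → criterion⇒critical (criterion-≅ G≅C₃ (from-yes (criterion? (C 3))))
    (inj₂ (inj₂ G≅C₄)) → criterion⇒critical (criterion-≅ G≅C₄ (from-yes (criterion? (C 4))))
  where
  forward : ∀ {n} (G : Graph n) → Connected G →
            LowerGameVertexCritical 3 G → G ≅ P 4 ⊎ G ≅ C 3 ⊎ G ≅ C 4
  -- On the empty graph Alice wins with no colors, so three is not the minimum.
  forward {zero} _ _ ((_ , lower) , _) = contradiction (lower 0 (complete λ ())) λ ()
  forward {suc n} G connected ((_ , lower) , deletion) =
    connected⇒P₄⊎C₃⊎C₄ G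
      (λ u on-every → ℕ.1+n≰n (lower 2 (on-every-edge⇒wins G on-every)))
      (λ {x} y≢x → let m , (win , _) , m<3 = deletion x in wins⇒star-center-avoiding G y≢x m<3 win)
      connected zero
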